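{- For every Steiner triple system $S$ on $n$ vertices, $\mathrm{mc}_3(S)\geq n-2\alpha^*_3(S)$.
   Context: A Steiner triple system is a $3$-uniform hypergraph in which each pair of distinct vertices is contained in exactly one edge. The shadow-graph $H^{(2)}$ of a hypergraph $H$ is the graph on $V(H)$ in which $\{x,y\}$ is an edge if and only if some $e\in E(H)$ satisfies $\{x,y\}\subseteq e$. $H$ is connected if $H^{(2)}$ is connected, and the components of $H$ are its maximal connected subgraphs (so an isolated vertex is a component on one vertex). An $r$-coloring of $H$ is a partition $\{E_1,\dots,E_r\}$ of $E(H)$ in which some of the sets may be empty. A monochromatic component of $H$ (with respect to this coloring) is a component of the hypergraph $(V(H),E_i)$ for some $i\in\{1,\dots,r\}$. $\mathrm{mc}_r(H)$ is the largest integer $m$ such that in every $r$-coloring of the edges of $H$ there is a monochromatic component on at least $m$ vertices. $\alpha_3^*(H)$ is the maximum integer $a$ such that there exist pairwise disjoint sets $X_1,X_2,X_3\subseteq V(H)$ with $|X_1|=|X_2|=|X_3|=a$ such that for every $e\in E(H)$ there is $i\in\{1,2,3\}$ with $e\cap X_i=\emptyset$. -}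

module Defs where

open import Data.Bool using (Bool; T)
open import Data.Fin using (Fin)
open import Data.Fin.Subset using (Subset; _∈_; _⊆_; _∩_; ∣_∣; Empty)
open import Data.Nat using (ℕ; _≤_)
open import Data.Product using (∃; ∃₂; ∃!; _×_)
open import Function.Bundles using (_⇔_)
open import Relation.Binary.Construct.Closure.ReflexiveTransitive using (Star)
open import Relation.Binary.PropositionalEquality using (_≡_; _≢_)

-- A hypergraph with vertex set Fin n, given by its set of edges.
Hypergraph : ℕ → Set
Hypergraph n = Subset n → Bool

infix 4 _∈ᴱ_ _⊑_

_∈ᴱ_ : ∀ {n} → Subset n → Hypergraph n → Set
e ∈ᴱ H = T (H e)

Uniform : ∀ {n} → ℕ → Hypergraph n → Set
Uniform k H = ∀ e → e ∈ᴱ H → ∣ e ∣ ≡ k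

record IsSteinerTripleSystem {n} (S : Hypergraph n) : Set where
  field
    uniform : Uniform 3 S
    pair    : ∀ x y → x ≢ y → ∃! _≡_ λ e → e ∈ᴱ S × x ∈ e × y ∈ e

-- Adjacency in the shadow graph H⁽²⁾.
Shadow : ∀ {n} → Hypergraph n → Fin n → Fin n → Set
Shadow H x y = x ≢ y × ∃ λ e → e ∈ᴱ H × x ∈ e × y ∈ e

record Subgraph {n} (H : Hypergraph n) : Set where
  field
    vertices : Subset n
    edges    : Hypergraph n
    edges⊆H  : ∀ e → e ∈ᴱ edges → e ∈ᴱ H
    edges⊆V  : ∀ e → e ∈ᴱ edges → e ⊆ vertices

open Subgraph public

_⊑_ : ∀ {n} {H : Hypergraph n} → Subgraph H → Subgraph H → Set
G ⊑ G′ = vertices G ⊆ vertices G′ × (∀ e → e ∈ᴱ edges G → e ∈ᴱ edges G′)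

-- Walks cannot leave `vertices G`, because every edge of G lies inside it.
-- The subgraph with no vertices counts as connected; it is a maximal
-- connected subgraph only when n = 0.
Connected : ∀ {n} {H : Hypergraph n} → Subgraph H → Set
Connected G = ∀ x y → x ∈ vertices G → y ∈ vertices G → Star (Shadow (edges G)) x y

IsComponent : ∀ {n} {H : Hypergraph n} → Subgraph H → Set
IsComponent {H = H} G =
  Connected G × (∀ (G′ : Subgraph H) → Connected G′ → G ⊑ G′ → G′ ⊑ G)

record Coloring {n} (r : ℕ) (H : Hypergraph n) : Set where
  field
    class    : Fin r → Hypergraph n
    cover    : ∀ e → e ∈ᴱ H ⇔ ∃ λ i → e ∈ᴱ class i
    disjoint : ∀ e i j → e ∈ᴱ class i → e ∈ᴱ class j → i ≡ j

open Coloring public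

HasMonochromaticComponent≥ : ∀ {n r} {H : Hypergraph n} → Coloring r H → ℕ → Set
HasMonochromaticComponent≥ c m =
  ∃₂ λ i (G : Subgraph (class c i)) → IsComponent G × m ≤ ∣ vertices G ∣

-- Maxima are stated relationally. IsLargest determines m uniquely.
IsLargest : (ℕ → Set) → ℕ → Set
IsLargest P m = P m × (∀ k → P k → k ≤ m)

-- m = mc_r(H)
IsMc : ∀ {n} → ℕ → Hypergraph n → ℕ → Set
IsMc r H = IsLargest λ m → (c : Coloring r H) → HasMonochromaticComponent≥ c m

record CrossIndependent {n} (H : Hypergraph n) (a : ℕ) : Set where
  field
    X        : Fin 3 → Subset n
    disjoint : ∀ i j → i ≢ j → Empty (X i ∩ X j)
    size     : ∀ i → ∣ X i ∣ ≡ a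
    avoids   : ∀ e → e ∈ᴱ H → ∃ λ i → Empty (e ∩ X i)

-- a = α₃*(H)
Isα₃* : ∀ {n} → Hypergraph n → ℕ → Set
Isα₃* H = IsLargest (CrossIndependent H)

{-# OPTIONS --safe #-}
-- Any two vertices lie in a common monochromatic component of some colour, and an
-- edge meeting three sets cannot have colour i if two of the sets share no component of
-- colour i.  So three sets, pairwise separated by the three different colours, cannot all
-- have more than α = α₃* vertices.  Suppose every component misses more than 2α vertices.
-- If components B and C of different colours cover V, then all vertices outside
-- B or outside C lie in one component A of the third colour, and the complements of A, B, C
-- are separated.  Hence there is no such cover, so for every colour each vertex x has a
-- neighbour that shares with x only the component of that colour.  Now let the cell of x
-- be the set of vertices that share all three components with x.  If x and p share only
-- one component and both have cells of size at most α, their cells and a single component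
-- cover V, a contradiction.  As among three separated cells one has size at most α,
-- a cell of that size can be excluded at every x, and then three separated cells
-- contradict the choice of α.
module Submission where

open import Data.Bool using (_∧_)
open import Data.Bool.Properties using (T?; T-∧)
open import Data.Empty using (⊥; ⊥-elim)
open import Data.Fin using (Fin; zero; suc)
open import Data.Fin.Patterns using (0F; 1F; 2F)
open import Data.Fin.Properties using (any?; _≟_)
open import Data.Fin.Subset using (Subset; _∈_; _⊆_; _⊃_; _∩_; _∪_; ∁; ⁅_⁆; ∣_∣; Empty; Nonempty; inside; outside)
  renaming (⊤ to full; ⊥ to ∅)
open import Data.Fin.Subset.Induction using (⊃-wellFounded; Acc; acc)
open import Data.Fin.Subset.Properties
open import Data.Nat using (ℕ; zero; suc; _≥_; _∸_; _*_; _+_; _≤_; _<_; z≤n; s≤s; _≤?_)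
open import Data.Nat.Properties hiding (_≟_)
open import Data.Product using (∃; _×_; _,_; proj₁; proj₂)
open import Data.Sum using (_⊎_; inj₁; inj₂; [_,_]′)
open import Data.Vec using ([]; _∷_; here; there)
open import Function using (_∘_; id)
open import Function.Bundles using (Equivalence)
open import Level using (0ℓ)
open import Relation.Binary using (Rel; Decidable; Symmetric)
open import Relation.Binary.Construct.Closure.ReflexiveTransitive using (Star; ε; _◅_; _◅◅_; return; reverse; map)
open import Relation.Binary.PropositionalEquality using (_≡_; _≢_; refl; sym; subst)
open import Relation.Nullary using (¬_; yes; no; contradiction)
open import Relation.Nullary.Decidable using (¬?; _×-dec_; ⌊_⌋; toWitness; fromWitness; decidable-stable)
open import Defs

-- Truncated subtraction and sizes of finite sets

m<n∸o⇒m+o<n : ∀ {m n o} → m < n ∸ o → m + o < n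
m<n∸o⇒m+o<n {m} m<n∸o =
  -- Nothing is truncated: `n ∸ o` exceeds `m`, so it is nonzero and `o < n`.
  m≤o∸n⇒m+n≤o (suc m) (<⇒≤ (m∸n≢0⇒n<m λ n∸o≡0 → n≮0 (subst (m <_) n∸o≡0 m<n∸o))) m<n∸o

∣p∪q∣≤∣p∣+∣q∣ : ∀ {n} (p q : Subset n) → ∣ p ∪ q ∣ ≤ ∣ p ∣ + ∣ q ∣
∣p∪q∣≤∣p∣+∣q∣ []            []            = z≤n
∣p∪q∣≤∣p∣+∣q∣ (outside ∷ p) (outside ∷ q) = ∣p∪q∣≤∣p∣+∣q∣ p q
∣p∪q∣≤∣p∣+∣q∣ (outside ∷ p) (inside  ∷ q) =
  ≤-trans (s≤s (∣p∪q∣≤∣p∣+∣q∣ p q)) (≤-reflexive (sym (+-suc _ _)))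
∣p∪q∣≤∣p∣+∣q∣ (inside  ∷ p) (outside ∷ q) = s≤s (∣p∪q∣≤∣p∣+∣q∣ p q)
∣p∪q∣≤∣p∣+∣q∣ (inside  ∷ p) (inside  ∷ q) =
  s≤s (≤-trans (∣p∪q∣≤∣p∣+∣q∣ p q) (+-monoʳ-≤ ∣ p ∣ (n≤1+n _)))

all∈p⇒n≤∣p∣ : ∀ {n} {p : Subset n} → (∀ x → x ∈ p) → n ≤ ∣ p ∣
all∈p⇒n≤∣p∣ {n} all∈p = ≤-trans (≤-reflexive (sym (∣⊤∣≡n n))) (p⊆q⇒∣p∣≤∣q∣ {p = full} λ {x} _ → all∈p x)

shrink : ∀ {n} (p : Subset n) k → k ≤ ∣ p ∣ → ∃ λ q → q ⊆ p × ∣ q ∣ ≡ k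
shrink {n} p zero k≤ = ∅ , (λ x∈⊥ → contradiction x∈⊥ ∉⊥) , ∣⊥∣≡0 n
shrink (outside ∷ p) (suc k) k≤ with q , q⊆p , ∣q∣≡k ← shrink p (suc k) k≤ =
  outside ∷ q , (λ { (there x∈q) → there (q⊆p x∈q) }) , ∣q∣≡k
shrink (inside ∷ p) (suc k) (s≤s k≤) with q , q⊆p , refl ← shrink p k k≤ =
  inside ∷ q , (λ { here → here ; (there x∈q) → there (q⊆p x∈q) }) , refl

-- Reachable sets of a decidable relation

module Reachability {n} {_∼_ : Rel (Fin n) 0ℓ} (_∼?_ : Decidable _∼_) where

  private
    Closed : Subset n → Set
    Closed p = ∀ {u v} → u ∈ p → u ∼ v → v ∈ p

    -- As long as some step leaves `p`, its endpoint is added. The set grows strictly inside a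
    -- finite vertex set, so this stops, and it stops at a closed set.
    saturate : ∀ {x} p → Acc _⊃_ p → x ∈ p → (∀ {y} → y ∈ p → Star _∼_ x y) →
               ∃ λ q → x ∈ q × Closed q × (∀ {y} → y ∈ q → Star _∼_ x y)
    saturate p (acc rec) x∈p reached
      with any? (λ u → any? (λ v → (u ∈? p) ×-dec ¬? (v ∈? p) ×-dec (u ∼? v)))
    ... | no ¬exit = p , x∈p , closed , reached
      where
      closed : Closed p
      closed u∈p u∼v = decidable-stable (_ ∈? p) λ v∉p → ¬exit (_ , _ , u∈p , v∉p , u∼v)
    ... | yes (u , v , u∈p , v∉p , u∼v) =
      saturate (p ∪ ⁅ v ⁆) (rec p⊂p∪v) (x∈p∪q⁺ (inj₁ x∈p)) reached′
      where
      p⊂p∪v : (p ∪ ⁅ v ⁆) ⊃ p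
      p⊂p∪v = (λ y∈p → x∈p∪q⁺ (inj₁ y∈p)) , v , x∈p∪q⁺ (inj₂ (x∈⁅x⁆ v)) , v∉p
      reached′ : ∀ {y} → y ∈ p ∪ ⁅ v ⁆ → Star _∼_ _ y
      reached′ y∈ with x∈p∪q⁻ p ⁅ v ⁆ y∈
      ... | inj₁ y∈p = reached y∈p
      ... | inj₂ y∈v with refl ← x∈⁅y⁆⇒x≡y v y∈v = reached u∈p ◅◅ return u∼v

    saturated : ∀ x → ∃ λ q → x ∈ q × Closed q × (∀ {y} → y ∈ q → Star _∼_ x y)
    saturated x = saturate ⁅ x ⁆ (⊃-wellFounded _) (x∈⁅x⁆ x) start
      where
      start : ∀ {y} → y ∈ ⁅ x ⁆ → Star _∼_ x y
      start y∈x with refl ← x∈⁅y⁆⇒x≡y x y∈x = ε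

  reach : Fin n → Subset n
  reach x = proj₁ (saturated x)

  ∈-reach⁻ : ∀ {x y} → y ∈ reach x → Star _∼_ x y
  ∈-reach⁻ {x} = proj₂ (proj₂ (proj₂ (saturated x)))

  ∈-reach⁺ : ∀ {x y} → Star _∼_ x y → y ∈ reach x
  ∈-reach⁺ {x} = go (proj₁ (proj₂ (saturated x)))
    where
    go : ∀ {u y} → u ∈ reach x → Star _∼_ u y → y ∈ reach x
    go u∈ ε            = u∈
    go u∈ (u∼v ◅ path) = go (proj₁ (proj₂ (proj₂ (saturated x))) u∈ u∼v) path

-- Components of a hypergraph

module ShadowComponents {n} (H : Hypergraph n) where

  shadow? : Decidable (Shadow H)
  shadow? x y = ¬? (x ≟ y) ×-dec anySubset? λ e → T? (H e) ×-dec (x ∈? e) ×-dec (y ∈? e)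

  open Reachability shadow? public

  shadow-sym : Symmetric (Shadow H)
  shadow-sym (x≢y , e , e∈H , x∈e , y∈e) = x≢y ∘ sym , e , e∈H , y∈e , x∈e

  edge⇒connected : ∀ {e x y} → e ∈ᴱ H → x ∈ e → y ∈ e → Star (Shadow H) x y
  edge⇒connected {e} {x} {y} e∈H x∈e y∈e with x ≟ y
  ... | yes refl = ε
  ... | no x≢y   = return (x≢y , e , e∈H , x∈e , y∈e)

  edge⊆reach : ∀ {e x y} → e ∈ᴱ H → y ∈ e → y ∈ reach x → e ⊆ reach x
  edge⊆reach e∈H y∈e y∈x z∈e = ∈-reach⁺ (∈-reach⁻ y∈x ◅◅ edge⇒connected e∈H y∈e z∈e)

  component : Fin n → Subgraph H
  component x = record
    { vertices = reach x
    -- Maximality also compares edges, so every edge inside `reach x` is taken.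
    ; edges    = λ e → H e ∧ ⌊ e ⊆? reach x ⌋
    ; edges⊆H  = λ e e∈ → proj₁ (Equivalence.to T-∧ e∈)
    ; edges⊆V  = λ e e∈ → toWitness {a? = e ⊆? reach x} (proj₂ (Equivalence.to (T-∧ {H e}) e∈))
    }

  component-edge : ∀ {e x} → e ∈ᴱ H → e ⊆ reach x → e ∈ᴱ edges (component x)
  component-edge {e} {x} e∈H e⊆x = Equivalence.from T-∧ (e∈H , fromWitness {a? = e ⊆? reach x} e⊆x)

  -- An edge that touches `reach x` lies inside it, so walks starting there stay in the component. A
  -- connected subgraph above the component contains `x`, and its walks from `x` are walks in `H`.
  component-isComponent : ∀ x → IsComponent (component x)
  component-isComponent x = connected , maximal
    where
    restrict : ∀ {u v} → u ∈ reach x → Star (Shadow H) u v → Star (Shadow (edges (component x))) u v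
    restrict u∈ ε = ε
    restrict u∈ ((u≢v , e , e∈H , u∈e , v∈e) ◅ path) =
      (u≢v , e , component-edge e∈H e⊆x , u∈e , v∈e) ◅ restrict (e⊆x v∈e) path
      where
      e⊆x : e ⊆ reach x
      e⊆x = edge⊆reach e∈H u∈e u∈

    connected : Connected (component x)
    connected u v u∈ v∈ = restrict u∈ (reverse shadow-sym (∈-reach⁻ u∈) ◅◅ ∈-reach⁻ v∈)

    maximal : ∀ G → Connected G → component x ⊑ G → G ⊑ component x
    maximal G conn (V⊆ , _) = V⊇ , λ e e∈ → component-edge (edges⊆H G e e∈) (V⊇ ∘ edges⊆V G e e∈)
      where
      V⊇ : vertices G ⊆ reach x
      V⊇ y∈ = ∈-reach⁺ (map widen (conn x _ (V⊆ (∈-reach⁺ ε)) y∈))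
        where
        widen : ∀ {u v} → Shadow (edges G) u v → Shadow H u v
        widen (u≢v , e , e∈ , u∈e , v∈e) = u≢v , e , edges⊆H G e e∈ , u∈e , v∈e

-- Forces `a`, `b`, `c` to be the three colours in some order, so that an argument made once applies
-- to all rotations of the colours.
Palette : (a b c : Fin 3) → Set
Palette a b c = ∀ i → i ≡ a ⊎ i ≡ b ⊎ i ≡ c

palette₀₁₂ : Palette 0F 1F 2F
palette₀₁₂ 0F = inj₁ refl
palette₀₁₂ 1F = inj₂ (inj₁ refl)
palette₀₁₂ 2F = inj₂ (inj₂ refl)

rotate : ∀ {a b c} → Palette a b c → Palette b c a
rotate pal i with pal i
... | inj₁ i≡a        = inj₂ (inj₂ i≡a)
... | inj₂ (inj₁ i≡b) = inj₁ i≡b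
... | inj₂ (inj₂ i≡c) = inj₂ (inj₁ i≡c)

-- Three partitions of the vertex set into blocks

module Blocks {n} (block : Fin 3 → Fin n → Subset n) where

  Joined : Fin 3 → Fin n → Fin n → Set
  Joined i x y = y ∈ block i x

  Apart : Fin 3 → Subset n → Subset n → Set
  Apart i P Q = ∀ {x y} → x ∈ P → y ∈ Q → ¬ Joined i x y

  -- The form in which the maximality of α₃* enters the covering argument.
  Balanced : ℕ → Set
  Balanced α = ∀ {a b c} → Palette a b c → ∀ {P Q R} → Apart a P Q → Apart b Q R → Apart c R P →
               ∣ P ∣ ≤ α ⊎ ∣ Q ∣ ≤ α ⊎ ∣ R ∣ ≤ α

  module Covering
    (joined-refl  : ∀ {i x} → Joined i x x)
    (joined-sym   : ∀ {i x y} → Joined i x y → Joined i y x)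
    (joined-trans : ∀ {i x y z} → Joined i x y → Joined i y z → Joined i x z)
    (joined       : ∀ x y → ∃ λ i → Joined i x y)
    -- `small` is the negation of the theorem for one colouring; `no-vertex` refutes it.
    {α} (balanced : Balanced α) (small : ∀ i x → ∣ block i x ∣ + 2 * α < n)
    where

    joined-cotrans : ∀ {i x y z} → Joined i x y → Joined i z y → Joined i x z
    joined-cotrans xy zy = joined-trans xy (joined-sym zy)

    joined₃ : ∀ {a b c} → Palette a b c → ∀ x y → Joined a x y ⊎ Joined b x y ⊎ Joined c x y
    joined₃ pal x y with i , xy ← joined x y with pal i
    ... | inj₁ refl        = inj₁ xy
    ... | inj₂ (inj₁ refl) = inj₂ (inj₁ xy)
    ... | inj₂ (inj₂ refl) = inj₂ (inj₂ xy)

    uncovered : ∀ {P Q : Subset n} {i z} → ∣ P ∣ ≤ α → ∣ Q ∣ ≤ α →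
                ¬ (∀ v → v ∈ P ⊎ v ∈ Q ⊎ v ∈ block i z)
    uncovered {P} {Q} {i} {z} P≤α Q≤α covered = <-irrefl refl (begin-strict
      n                                 ≤⟨ all∈p⇒n≤∣p∣ all ⟩
      ∣ block i z ∪ P ∪ Q ∣             ≤⟨ ∣p∪q∣≤∣p∣+∣q∣ (block i z) (P ∪ Q) ⟩
      ∣ block i z ∣ + ∣ P ∪ Q ∣         ≤⟨ +-monoʳ-≤ _ (∣p∪q∣≤∣p∣+∣q∣ P Q) ⟩
      -- `2 * α` unfolds to `α + (α + 0)`, hence the bound `m≤m+n α 0`.
      ∣ block i z ∣ + (∣ P ∣ + ∣ Q ∣)   ≤⟨ +-monoʳ-≤ ∣ block i z ∣ (+-mono-≤ P≤α (≤-trans Q≤α (m≤m+n α 0))) ⟩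
      ∣ block i z ∣ + 2 * α             <⟨ small i z ⟩
      n                                 ∎)
      where
      open ≤-Reasoning
      all : ∀ v → v ∈ block i z ∪ P ∪ Q
      all v with covered v
      ... | inj₁ v∈P        = x∈p∪q⁺ (inj₂ (x∈p∪q⁺ (inj₁ v∈P)))
      ... | inj₂ (inj₁ v∈Q) = x∈p∪q⁺ (inj₂ (x∈p∪q⁺ (inj₂ v∈Q)))
      ... | inj₂ (inj₂ v∈z) = x∈p∪q⁺ (inj₁ v∈z)

    ∁-large : ∀ i x → ¬ ∣ ∁ (block i x) ∣ ≤ α
    ∁-large i x ∁≤α = uncovered {P = ∁ (block i x)} ∁≤α ∁≤α covered
      where
      covered : ∀ v → v ∈ ∁ (block i x) ⊎ v ∈ ∁ (block i x) ⊎ v ∈ block i x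
      covered v with v ∈? block i x
      ... | yes v∈ = inj₂ (inj₂ v∈)
      ... | no v∉  = inj₁ (x∉p⇒x∈∁p v∉)

    escape : ∀ i x → ∃ λ u → ¬ Joined i x u
    escape i x with any? (λ u → ¬? (u ∈? block i x))
    ... | yes exit = exit
    ... | no ¬exit = ⊥-elim (<-irrefl refl (<-≤-trans (small i x)
            (≤-trans (all∈p⇒n≤∣p∣ λ u → decidable-stable (u ∈? _) λ u∉ → ¬exit (u , u∉)) (m≤m+n _ _))))

    -- Let B and C be the blocks of `x` in colours `b` and `c`. If they cover, a vertex outside B
    -- lies in C and one outside C lies in B, so only colour `a` can join the two (`bridge`). Both
    -- kinds exist, so all of them lie in the block A of `u`. Thus A contains the complement of B, B
    -- that of C, and C that of A. Hence the complements are apart, yet none is small.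
    two-blocks-miss : ∀ {a b c} → Palette a b c → ∀ x → ¬ (∀ w → Joined b x w ⊎ Joined c x w)
    two-blocks-miss {a} {b} {c} pal x covered
      with u , ¬bu ← escape b x | v , ¬cv ← escape c x =
      [ ∁-large a u , [ ∁-large b x , ∁-large c x ]′ ]′ (balanced pal
        (λ p∈ q∈ pq → x∈∁p⇒x∉p p∈ (joined-cotrans (a-side (x∈∁p⇒x∉p q∈)) pq))
        (λ q∈ r∈ qr → x∈∁p⇒x∉p q∈ (joined-cotrans (b-side (x∈∁p⇒x∉p r∈)) qr))
        (λ {r} {p} r∈ p∈ rp → x∈∁p⇒x∉p r∈ (joined-cotrans (¬a⇒c (x∈∁p⇒x∉p p∈)) rp)))
      where
      b-side : ∀ {w} → ¬ Joined c x w → Joined b x w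
      b-side {w} ¬c = [ id , (λ cw → contradiction cw ¬c) ]′ (covered w)

      c-side : ∀ {w} → ¬ Joined b x w → Joined c x w
      c-side {w} ¬b = [ (λ bw → contradiction bw ¬b) , id ]′ (covered w)

      bridge : ∀ {q r} → ¬ Joined b x q → ¬ Joined c x r → Joined a q r
      bridge {q} {r} ¬bq ¬cr with joined₃ pal q r
      ... | inj₁ qr        = qr
      ... | inj₂ (inj₁ qr) = contradiction (joined-cotrans (b-side ¬cr) qr) ¬bq
      ... | inj₂ (inj₂ qr) = contradiction (joined-trans (c-side ¬bq) qr) ¬cr

      a-side : ∀ {q} → ¬ Joined b x q → Joined a u q
      a-side ¬bq = joined-cotrans (bridge ¬bu ¬cv) (bridge ¬bq ¬cv)

      ¬a⇒c : ∀ {p} → ¬ Joined a u p → Joined c x p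
      ¬a⇒c {p} ¬ap = decidable-stable (p ∈? block c x) λ ¬cp → ¬ap (bridge ¬bu ¬cp)

    -- Otherwise the `b`- and `c`-blocks of `x` cover: a vertex `a`-joined to `x` is not `a`-joined
    -- to `y`, so it is joined to `y`, and hence to `x`, in `b` or `c`.
    joined-twice⇒joined : ∀ {a b c} → Palette a b c → ∀ {x y} → Joined b x y → Joined c x y → Joined a x y
    joined-twice⇒joined {a} {b} {c} pal {x} {y} bxy cxy =
      decidable-stable (y ∈? block a x) λ ¬axy → two-blocks-miss pal x (covered ¬axy)
      where
      covered : ¬ Joined a x y → ∀ w → Joined b x w ⊎ Joined c x w
      covered ¬axy w with joined₃ pal x w | joined₃ pal y w
      ... | inj₂ bc | _                = bc
      ... | inj₁ aw | inj₁ ayw         = contradiction (joined-cotrans aw ayw) ¬axy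
      ... | inj₁ aw | inj₂ (inj₁ byw)  = inj₁ (joined-trans bxy byw)
      ... | inj₁ aw | inj₂ (inj₂ cyw)  = inj₂ (joined-trans cxy cyw)

    record JoinedOnly (a b c : Fin 3) (x y : Fin n) : Set where
      constructor only
      field
        join : Joined a x y
        ¬b   : ¬ Joined b x y
        ¬c   : ¬ Joined c x y

    neighbour : ∀ {a b c} → Palette a b c → ∀ x → ∃ (JoinedOnly a b c x)
    neighbour {a} {b} {c} pal x with any? (λ y → ¬? (y ∈? block b x) ×-dec ¬? (y ∈? block c x))
    ... | yes (y , ¬b , ¬c) = y , only join ¬b ¬c
      where
      join : Joined a x y
      join with joined₃ pal x y
      ... | inj₁ ay        = ay
      ... | inj₂ (inj₁ by) = contradiction by ¬b
      ... | inj₂ (inj₂ cy) = contradiction cy ¬c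
    ... | no ¬y = ⊥-elim (two-blocks-miss pal x covered)
      where
      covered : ∀ w → Joined b x w ⊎ Joined c x w
      covered w with w ∈? block b x | w ∈? block c x
      ... | yes bw | _      = inj₁ bw
      ... | no  _  | yes cw = inj₂ cw
      ... | no ¬bw | no ¬cw = contradiction (w , ¬bw , ¬cw) ¬y

    cell : Fin n → Subset n
    cell x = block 0F x ∩ block 1F x ∩ block 2F x

    cell⇒joined : ∀ {x y} → y ∈ cell x → ∀ i → Joined i x y
    cell⇒joined {x} y∈ i
      with y0 , y12 ← x∈p∩q⁻ (block 0F x) _ y∈
      with y1 , y2 ← x∈p∩q⁻ (block 1F x) _ y12
      with i
    ... | 0F = y0
    ... | 1F = y1
    ... | 2F = y2

    joined-twice⇒cell : ∀ {a b c} → Palette a b c → ∀ {x y} → Joined a x y → Joined b x y → y ∈ cell x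
    joined-twice⇒cell pal {x} {y} axy bxy = x∈p∩q⁺ (all 0F , x∈p∩q⁺ (all 1F , all 2F))
      where
      all : ∀ i → Joined i x y
      all i with pal i
      ... | inj₁ refl        = axy
      ... | inj₂ (inj₁ refl) = bxy
      -- Two rotations give the order `c`, `a`, `b`, which makes `c` the inferred colour.
      ... | inj₂ (inj₂ refl) = joined-twice⇒joined (rotate (rotate pal)) axy bxy

    cells-apart : ∀ {i x y} → ¬ Joined i x y → Apart i (cell x) (cell y)
    cells-apart {i} ¬xy u∈ v∈ uv =
      ¬xy (joined-cotrans (joined-trans (cell⇒joined u∈ i) uv) (cell⇒joined v∈ i))

    -- A triangle whose sides `xp`, `xq`, `pq` are joined in exactly one colour each: `a`, `b`, `c`.
    module Fork {a b c} (pal : Palette a b c) {x p q}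
                (xp : JoinedOnly a b c x p) (xq : JoinedOnly b c a x q) where
      open JoinedOnly xp renaming (join to axp; ¬b to ¬bxp; ¬c to ¬cxp)
      open JoinedOnly xq renaming (join to bxq; ¬b to ¬cxq; ¬c to ¬axq)

      ¬apq : ¬ Joined a p q
      ¬apq apq = ¬axq (joined-trans axp apq)

      ¬bpq : ¬ Joined b p q
      ¬bpq bpq = ¬bxp (joined-cotrans bxq bpq)

      cpq : Joined c p q
      cpq with joined₃ pal p q
      ... | inj₁ apq        = contradiction apq ¬apq
      ... | inj₂ (inj₁ bpq) = contradiction bpq ¬bpq
      ... | inj₂ (inj₂ cpq) = cpq

      -- If `v` is `b`-joined to `q`, compare it with `p`; if `c`-joined, compare it with `x`.
      -- Transitivity along the triangle either contradicts a missing colour or joins `v` in two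
      -- colours to `x`, `p` or `q`.
      covered : ∀ v → v ∈ cell x ⊎ v ∈ cell p ⊎ v ∈ block a q
      covered v with joined₃ pal q v
      ... | inj₁ aqv = inj₂ (inj₂ aqv)
      ... | inj₂ (inj₁ bqv) with joined₃ pal p v
      ...   | inj₁ apv        = inj₁ (joined-twice⇒cell pal (joined-trans axp apv) (joined-trans bxq bqv))
      ...   | inj₂ (inj₁ bpv) = contradiction (joined-cotrans bpv bqv) ¬bpq
      ...   | inj₂ (inj₂ cpv) =
        inj₂ (inj₂ (joined-twice⇒joined pal bqv (joined-trans (joined-sym cpq) cpv)))
      covered v | inj₂ (inj₂ cqv) with joined₃ pal x v
      ...   | inj₁ axv        =
        inj₂ (inj₁ (joined-twice⇒cell (rotate (rotate pal))
          (joined-trans cpq cqv) (joined-trans (joined-sym axp) axv)))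
      ...   | inj₂ (inj₁ bxv) =
        inj₂ (inj₂ (joined-twice⇒joined pal (joined-trans (joined-sym bxq) bxv) cqv))
      ...   | inj₂ (inj₂ cxv) = contradiction (joined-cotrans cxv cqv) ¬cxq

    small-cells⇒¬only : ∀ {a b c} → Palette a b c → ∀ {x p} →
                        ∣ cell x ∣ ≤ α → ∣ cell p ∣ ≤ α → ¬ JoinedOnly a b c x p
    small-cells⇒¬only pal {x} x≤α p≤α xp with _ , xq ← neighbour (rotate pal) x =
      uncovered x≤α p≤α (Fork.covered pal xp xq)

    -- Take one neighbour of `x` for each colour, joined to `x` in that colour only. Their cells are
    -- apart, so one is small, and a small cell at `x` then contradicts `small-cells⇒¬only`.
    cell-large : ∀ x → ¬ ∣ cell x ∣ ≤ α
    cell-large x x≤α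
      with _ , xp ← neighbour palette₀₁₂ x
         | _ , xq ← neighbour (rotate palette₀₁₂) x
         | _ , xr ← neighbour (rotate (rotate palette₀₁₂)) x
      with balanced palette₀₁₂ (cells-apart (Fork.¬apq palette₀₁₂ xp xq))
                               (cells-apart (Fork.¬apq (rotate palette₀₁₂) xq xr))
                               (cells-apart (Fork.¬apq (rotate (rotate palette₀₁₂)) xr xp))
    ... | inj₁ p≤α        = small-cells⇒¬only palette₀₁₂ x≤α p≤α xp
    ... | inj₂ (inj₁ q≤α) = small-cells⇒¬only (rotate palette₀₁₂) x≤α q≤α xq
    ... | inj₂ (inj₂ r≤α) = small-cells⇒¬only (rotate (rotate palette₀₁₂)) x≤α r≤α xr

    no-vertex : ¬ Fin n
    no-vertex x
      with p , xp ← neighbour palette₀₁₂ x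
         | q , xq ← neighbour (rotate palette₀₁₂) x
      -- The sides `xp`, `xq`, `pq` have only the colours 0, 1, 2, so colours 2, 0, 1 separate `p`
      -- from `x`, `x` from `q`, and `q` from `p`.
      with balanced (rotate (rotate palette₀₁₂))
             (cells-apart (JoinedOnly.¬c xp ∘ joined-sym))
             (cells-apart (JoinedOnly.¬c xq))
             (cells-apart (Fork.¬bpq palette₀₁₂ xp xq ∘ joined-sym))
    ... | inj₁ p≤α        = cell-large p p≤α
    ... | inj₂ (inj₁ x≤α) = cell-large x x≤α
    ... | inj₂ (inj₂ q≤α) = cell-large q q≤α

-- Colourings of Steiner triple systems

module ColoredSteiner {n} {S : Hypergraph n} (sts : IsSteinerTripleSystem S) (κ : Coloring 3 S) where

  open module Component i = ShadowComponents (class κ i)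
  open Blocks reach

  joined-sym : ∀ {i x y} → Joined i x y → Joined i y x
  joined-sym {i} xy = ∈-reach⁺ i (reverse (shadow-sym i) (∈-reach⁻ i xy))

  joined-trans : ∀ {i x y z} → Joined i x y → Joined i y z → Joined i x z
  joined-trans {i} xy yz = ∈-reach⁺ i (∈-reach⁻ i xy ◅◅ ∈-reach⁻ i yz)

  -- The triple through two distinct vertices has a colour. For equal vertices the empty walk
  -- serves, and colour 0 is an arbitrary choice.
  joined : ∀ x y → ∃ λ i → Joined i x y
  joined x y with x ≟ y
  ... | yes refl = 0F , ∈-reach⁺ 0F ε
  ... | no x≢y
    with e , (e∈S , x∈e , y∈e) , _ ← IsSteinerTripleSystem.pair sts x y x≢y
    with i , e∈i ← Equivalence.to (cover κ e) e∈S = i , ∈-reach⁺ i (edge⇒connected i e∈i x∈e y∈e)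

  -- A common vertex of two sets would be joined to itself in their separating colour. An edge
  -- meeting all three sets would have colour `a`, `b` or `c` and join the pair which that colour
  -- separates.
  apart⇒crossIndependent : ∀ {a b c} → Palette a b c → ∀ {P Q R k} →
    Apart a P Q → Apart b Q R → Apart c R P → ∣ P ∣ ≡ k → ∣ Q ∣ ≡ k → ∣ R ∣ ≡ k → CrossIndependent S k
  apart⇒crossIndependent {a} {b} {c} pal {P} {Q} {R} {k} PQ QR RP ∣P∣ ∣Q∣ ∣R∣ = record
    { X = X ; disjoint = disj ; size = λ { 0F → ∣P∣ ; 1F → ∣Q∣ ; 2F → ∣R∣ } ; avoids = missed }
    where
    X : Fin 3 → Subset n
    X 0F = P
    X 1F = Q
    X 2F = R

    disj′ : ∀ {i U V} → Apart i U V → Empty (U ∩ V)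
    disj′ {i} {U} {V} UV (x , x∈) with x∈U , x∈V ← x∈p∩q⁻ U V x∈ = UV x∈U x∈V (∈-reach⁺ i ε)

    flip-empty : ∀ {U V : Subset n} → Empty (U ∩ V) → Empty (V ∩ U)
    flip-empty {U} {V} = subst Empty (∩-comm U V)

    disj : ∀ i j → i ≢ j → Empty (X i ∩ X j)
    disj 0F 0F i≢j = contradiction refl i≢j
    disj 0F 1F _   = disj′ PQ
    disj 0F 2F _   = flip-empty {R} (disj′ RP)
    disj 1F 0F _   = flip-empty {P} (disj′ PQ)
    disj 1F 1F i≢j = contradiction refl i≢j
    disj 1F 2F _   = disj′ QR
    disj 2F 0F _   = disj′ RP
    disj 2F 1F _   = flip-empty {Q} (disj′ QR)
    disj 2F 2F i≢j = contradiction refl i≢j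

    misses : ∀ {i e U V} → e ∈ᴱ class κ i → Apart i U V → Nonempty (e ∩ U) → ¬ Nonempty (e ∩ V)
    misses {i} {e} {U} {V} e∈i UV (u , u∈) (v , v∈)
      with u∈e , u∈U ← x∈p∩q⁻ e U u∈ | v∈e , v∈V ← x∈p∩q⁻ e V v∈ =
      UV u∈U v∈V (∈-reach⁺ i (edge⇒connected i e∈i u∈e v∈e))

    missed : ∀ e → e ∈ᴱ S → ∃ λ i → Empty (e ∩ X i)
    missed e e∈S with nonempty? (e ∩ P) | nonempty? (e ∩ Q) | nonempty? (e ∩ R)
    ... | no empty | _     | _     = 0F , empty
    ... | yes _ | no empty | _     = 1F , empty
    ... | yes _ | yes _ | no empty = 2F , empty
    ... | yes p | yes q | yes r with i , e∈i ← Equivalence.to (cover κ e) e∈S with pal i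
    ...   | inj₁ refl        = contradiction q (misses e∈i PQ p)
    ...   | inj₂ (inj₁ refl) = contradiction r (misses e∈i QR q)
    ...   | inj₂ (inj₂ refl) = contradiction p (misses e∈i RP r)

  balanced : ∀ {α} → Isα₃* S α → Balanced α
  balanced {α} (_ , largest) pal {P} {Q} {R} PQ QR RP with ∣ P ∣ ≤? α | ∣ Q ∣ ≤? α | ∣ R ∣ ≤? α
  ... | yes P≤α | _       | _       = inj₁ P≤α
  ... | no  _   | yes Q≤α | _       = inj₂ (inj₁ Q≤α)
  ... | no  _   | no  _   | yes R≤α = inj₂ (inj₂ R≤α)
  ... | no  P≰α | no  Q≰α | no  R≰α
    -- α₃* asks for sets of equal size, so all three are cut down to `suc α`, one more than the
    -- maximum.
    with P′ , P′⊆P , ∣P′∣ ← shrink P (suc α) (≰⇒> P≰α)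
       | Q′ , Q′⊆Q , ∣Q′∣ ← shrink Q (suc α) (≰⇒> Q≰α)
       | R′ , R′⊆R , ∣R′∣ ← shrink R (suc α) (≰⇒> R≰α) =
    contradiction
      (largest (suc α) (apart⇒crossIndependent pal
        (λ p q → PQ (P′⊆P p) (Q′⊆Q q)) (λ q r → QR (Q′⊆Q q) (R′⊆R r)) (λ r p → RP (R′⊆R r) (P′⊆P p))
        ∣P′∣ ∣Q′∣ ∣R′∣))
      1+n≰n

  large-component : ∀ {α} → Isα₃* S α → Fin n → HasMonochromaticComponent≥ κ (n ∸ 2 * α)
  large-component {α} isα x with any? (λ i → any? (λ y → n ∸ 2 * α ≤? ∣ reach i y ∣))
  ... | yes (i , y , large) = i , component i y , component-isComponent i y , large
  ... | no ¬large =
    ⊥-elim (Covering.no-vertex (∈-reach⁺ _ ε) joined-sym joined-trans joined (balanced isα) small x)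
    where
    small : ∀ i y → ∣ reach i y ∣ + 2 * α < n
    small i y = m<n∸o⇒m+o<n (≰⇒> λ large → ¬large (i , y , large))

theorem1p3 : ∀ (n : ℕ) (S : Hypergraph n) → IsSteinerTripleSystem S →
    ∀ (mc α : ℕ) → IsMc 3 S mc → Isα₃* S α → mc ≥ n ∸ 2 * α
theorem1p3 zero    S sts mc α isMc isα = ≤-trans (m∸n≤m 0 (2 * α)) z≤n
theorem1p3 (suc n) S sts mc α isMc isα =
  -- `mc` is the largest size guaranteed in every colouring, so it suffices to guarantee this one.
  proj₂ isMc _ λ κ → ColoredSteiner.large-component sts κ isα zero
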